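{- For a non-negative integer $m$, let $k^*_m$ denote the minimum $k \ge 0$ such that there exist non-negative integers $x_1,\dots,x_k,y_1,\dots,y_k$ with $\sum_{i=1}^k 2^{x_i}3^{y_i} = m$ (so $k^*_0 = 0$). For a positive integer $n$ let $$\mathcal{A}^*(n) := \frac{1}{2^n}\sum_{m=0}^{2^n-1} k^*_m .$$ Then $\mathcal{A}^*(n) \in \Omega(n/\lg n)$ as $n \to \infty$.
   Context: A representation of a non-negative integer $m$ in the double-base number system is a tuple $[k, \langle x_i\rangle_{i=1}^k, \langle y_i\rangle_{i=1}^k]$ of non-negative integers with $\sum_{i=1}^k 2^{x_i}3^{y_i}=m$; $k$ is its number of terms, and $k^*_m$ is the number of terms of a representation of $m$ with the fewest terms. $\lg$ denotes the base-2 logarithm. -}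

module Defs where

open import Data.Integer.Base using (+_; -[1+_])
open import Data.List.Base using (map; upTo)
open import Data.Nat.Base
open import Data.Nat.ListAction using (sum)
open import Data.Nat.Properties
open import Data.Product.Base using (∃; _×_; _,_; proj₁)
open import Data.Rational.Base as ℚ using (ℚ; mkℚ; 0ℚ)
open import Data.Vec.Base as Vec using (Vec; []; _∷_)
open import Level using (Level)
open import Relation.Binary.PropositionalEquality
open import Relation.Nullary.Decidable using (Dec; yes; no; map′; _×-dec_)
open import Relation.Nullary.Negation using (contradiction)
open import Relation.Unary using (Pred; Decidable)

private
  variable
    ℓ : Level

------------------------------------------------------------------------
-- Least natural numbers

IsLeast : Pred ℕ ℓ → Pred ℕ ℓ
IsLeast P k = P k × (∀ j → P j → k ≤ j)

least : {P : Pred ℕ ℓ} → Decidable P → ∀ n → P n → ∃ (IsLeast P)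
least P? zero p = zero , p , λ _ _ → z≤n
least {P = P} P? (suc n) p with P? zero
... | yes p₀ = zero , p₀ , λ _ _ → z≤n
... | no ¬p₀ with least {P = λ k → P (suc k)} (λ k → P? (suc k)) n p
...   | k , pk , k≤ = suc k , pk , λ where
          zero    p₀ → contradiction p₀ ¬p₀
          (suc j) pj → s≤s (k≤ j pj)

------------------------------------------------------------------------
-- Double-base representations

term : ℕ → ℕ → ℕ
term x y = 2 ^ x * 3 ^ y

value : ∀ {k} → Vec ℕ k → Vec ℕ k → ℕ
value xs ys = Vec.sum (Vec.zipWith term xs ys)

Representable : ℕ → ℕ → Set
Representable m k = ∃ λ (xs : Vec ℕ k) → ∃ λ (ys : Vec ℕ k) → value xs ys ≡ m

private
  n<[2+b]^n : ∀ b n → n < (2 + b) ^ n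
  n<[2+b]^n b zero    = z<s
  n<[2+b]^n b (suc n) = begin-strict
    suc n                        ≤⟨ n<[2+b]^n b n ⟩
    (2 + b) ^ n                  <⟨ ^-monoʳ-< (2 + b) (s<s z<s) (n<1+n n) ⟩
    (2 + b) ^ suc n              ∎
    where open ≤-Reasoning

  x<term : ∀ x y → x < term x y
  x<term x y = <-≤-trans (n<[2+b]^n 0 x) (m≤m*n (2 ^ x) (3 ^ y) {{m^n≢0 3 y}})

  y<term : ∀ x y → y < term x y
  y<term x y = <-≤-trans (n<[2+b]^n 1 y) (m≤n*m (3 ^ y) (2 ^ x) {{m^n≢0 2 x}})

representable? : ∀ m k → Dec (Representable m k)
representable? m zero    = map′ (λ 0≡m → [] , [] , 0≡m) (λ { ([] , [] , 0≡m) → 0≡m }) (0 ≟ m)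
representable? m (suc k) = map′ to from
  (anyUpTo? (λ x → anyUpTo? (λ y →
     term x y ≤? m ×-dec representable? (m ∸ term x y) k) m) m)
  where
  to : (∃ λ x → x < m × ∃ λ y → y < m × term x y ≤ m × Representable (m ∸ term x y) k) →
       Representable m (suc k)
  to (x , _ , y , _ , t≤m , xs , ys , eq) =
    x ∷ xs , y ∷ ys , trans (cong (λ v → term x y + v) eq) (m+[n∸m]≡n t≤m)

  from : Representable m (suc k) →
         ∃ λ x → x < m × ∃ λ y → y < m × term x y ≤ m × Representable (m ∸ term x y) k
  from (x ∷ xs , y ∷ ys , refl) =
    x , <-≤-trans (x<term x y) t≤m , y , <-≤-trans (y<term x y) t≤m , t≤m ,
    xs , ys , sym (m+n∸m≡n (term x y) (value xs ys))
    where
    t≤m : term x y ≤ term x y + value xs ys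
    t≤m = m≤m+n (term x y) (value xs ys)

representable-by-ones : ∀ m → Representable m m
representable-by-ones zero    = [] , [] , refl
representable-by-ones (suc m) with representable-by-ones m
... | xs , ys , eq = 0 ∷ xs , 0 ∷ ys , cong suc eq

fewestTerms : ∀ m → ∃ (IsLeast (Representable m))
fewestTerms m = least (representable? m) m (representable-by-ones m)

k* : ℕ → ℕ
k* m = proj₁ (fewestTerms m)

𝒜* : ℕ → ℚ
𝒜* n = (+ sum (map k* (upTo (2 ^ n)))) ℚ./ (2 ^ n)
  where instance _ = m^n≢0 2 n

------------------------------------------------------------------------
-- Real numbers as one-sided Dedekind cuts: a LowerCut is the set of
-- rationals strictly below a real, an UpperCut those strictly above it.

LowerCut UpperCut : Set₁
LowerCut = ℚ → Set
UpperCut = ℚ → Set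

-- lg n < a / b  iff  n ^ b < 2 ^ a, for n ≥ 1. For negative a both sides
-- are multiplied by 2 ^ (- a).
lg : ℕ → UpperCut
lg n (mkℚ (+ a)    b-1 _) = n ^ suc b-1 < 2 ^ a
lg n (mkℚ -[1+ a ] b-1 _) = n ^ suc b-1 * 2 ^ suc a < 1

-- The quotient of a rational p > 0 by a real u > 0: q < p / u iff
-- q * r < p for some rational r > u.
infixl 7 _÷_
_÷_ : ℚ → UpperCut → LowerCut
(p ÷ u) q = ∃ λ r → u r × q ℚ.* r ℚ.< p

-- f n ≥ c * g n for all large n, where c * g n is the supremum of the
-- c * q with q < g n. A rational c > 0 exists whenever a real one does,
-- provided g is eventually non-negative.
infix 4 _∈Ω_
_∈Ω_ : (ℕ → ℚ) → (ℕ → LowerCut) → Set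
f ∈Ω g = ∃ λ c → 0ℚ ℚ.< c × ∃ λ N → ∀ n → N ≤ n → ∀ q → g n q → c ℚ.* q ℚ.≤ f n

{-# OPTIONS --safe #-}
-- There are at most (1 + n²)ᴷ sums of K terms 2ˣ3ʸ with x, y < n, where a term
-- may also be 0 so as to cover all shorter sums. With 2^ℓ ≤ n < 2^(1 + ℓ) and
-- K = ⌊(n - 1) / 4ℓ⌋ this is at most 2^(n - 1), so at least half of the
-- m < 2ⁿ need more than K terms. Hence the average is at least
-- (K + 1) / 2 ≥ n / 8ℓ, and ℓ ≤ lg n.
module Submission where

open import Defs
open import Data.Integer.Base as ℤ using (+_; -[1+_])
import Data.Integer.Properties as ℤ
open import Data.List.Base
  using (List; []; _∷_; [_]; _++_; map; length; upTo; cartesianProductWith)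
open import Data.List.Membership.Propositional using (_∈_)
open import Data.List.Membership.Propositional.Properties
open import Data.List.Properties using (length-++; length-++-sucʳ; length-map; length-upTo)
open import Data.List.Relation.Unary.All as All using ()
open import Data.List.Relation.Unary.Any using (here; there)
open import Data.List.Relation.Unary.AllPairs using ([]; _∷_)
open import Data.List.Relation.Unary.Unique.Propositional using (Unique)
open import Data.List.Relation.Unary.Unique.Propositional.Properties using (upTo⁺)
open import Data.Nat.Base as ℕ hiding (_/_)
open import Data.Nat.DivMod using (m/n*n≤m; m≡m%n+[m/n]*n; m%n<n)
open import Data.Nat.ListAction using (sum)
open import Data.Nat.Properties
open import Data.Nat.Tactic.RingSolver using (solve-∀)
open import Data.Product.Base using (∃; _×_; _,_)
open import Data.Rational.Base as ℚ using (mkℚ; 0ℚ; _/_; toℚᵘ)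
import Data.Rational.Properties as ℚ
open import Data.Rational.Unnormalised.Base as ℚᵘ using (mkℚᵘ; *≤*)
import Data.Rational.Unnormalised.Properties as ℚᵘ
open import Data.Sum.Base using (inj₁; inj₂)
open import Data.Vec.Base using (Vec; []; _∷_)
open import Level using (Level)
open import Relation.Binary.PropositionalEquality hiding ([_])
open import Relation.Nullary.Negation using (contradiction)

private
  variable
    a : Level
    A B C : Set a

-- Counting in lists.

length-cartesianProductWith : (f : A → B → C) (xs : List A) (ys : List B) →
  length (cartesianProductWith f xs ys) ≡ length xs * length ys
length-cartesianProductWith f []       ys = refl
length-cartesianProductWith f (x ∷ xs) ys = trans (length-++ (map (f x) ys))
  (cong₂ _+_ (length-map (f x) ys) (length-cartesianProductWith f xs ys))

∈-++-remove : {x y : A} (ys : List A) {zs : List A} →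
  x ≢ y → y ∈ ys ++ [ x ] ++ zs → y ∈ ys ++ zs
∈-++-remove ys x≢y y∈ with ∈-++⁻ ys y∈
... | inj₁ y∈ys          = ∈-++⁺ˡ y∈ys
... | inj₂ (here y≡x)    = contradiction (sym y≡x) x≢y
... | inj₂ (there y∈zs)  = ∈-++⁺ʳ ys y∈zs

-- Markov's inequality for counting measure, with the subtraction moved across.
length*bound≤sum : (f : A → ℕ) (j : ℕ) {xs : List A} (ys : List A) → Unique xs →
  (∀ {x} → x ∈ xs → f x < j → x ∈ ys) →
  length xs * j ≤ sum (map f xs) + length ys * j
length*bound≤sum f j          ys []          small⇒∈ = z≤n
length*bound≤sum f j {x ∷ xs} ys (x∉xs ∷ xs!) small⇒∈ with <-≤-connex (f x) j
... | inj₂ j≤fx = begin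
  j + length xs * j                            ≤⟨ +-mono-≤ j≤fx (length*bound≤sum f j ys xs! (λ y∈ → small⇒∈ (there y∈))) ⟩
  f x + (sum (map f xs) + length ys * j)       ≡⟨ +-assoc (f x) _ _ ⟨
  f x + sum (map f xs) + length ys * j         ∎
  where open ≤-Reasoning
-- A head below the bound contributes nothing, and its `j` is paid for by deleting one occurrence of
-- it from `ys`. As `xs` is free of repetitions, the later small elements all survive the deletion.
... | inj₁ fx<j with ∈-∃++ (small⇒∈ (here refl) fx<j)
...   | us , vs , refl = begin
  j + length xs * j                                   ≤⟨ +-monoʳ-≤ j (length*bound≤sum f j (us ++ vs) xs! small⇒∈′) ⟩
  j + (sum (map f xs) + length (us ++ vs) * j)        ≡⟨ swap j (sum (map f xs)) _ ⟩
  sum (map f xs) + suc (length (us ++ vs)) * j        ≤⟨ +-monoˡ-≤ _ (m≤n+m _ (f x)) ⟩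
  f x + sum (map f xs) + suc (length (us ++ vs)) * j  ≡⟨ cong (λ l → f x + sum (map f xs) + l * j) (length-++-sucʳ us x vs) ⟨
  f x + sum (map f xs) + length (us ++ [ x ] ++ vs) * j ∎
  where
  open ≤-Reasoning
  swap : ∀ a b c → a + (b + c) ≡ b + (a + c)
  swap = solve-∀
  small⇒∈′ : ∀ {y} → y ∈ xs → f y < j → y ∈ us ++ vs
  small⇒∈′ y∈xs fy<j = ∈-++-remove us (All.lookup x∉xs y∈xs) (small⇒∈ (there y∈xs) fy<j)

-- Enumerating the short sums.

^-cancelˡ-< : ∀ b .{{_ : NonZero b}} {m n} → b ^ m < b ^ n → m < n
^-cancelˡ-< b {m} {n} bᵐ<bⁿ with <-≤-connex m n
... | inj₁ m<n = m<n
... | inj₂ n≤m = contradiction (^-monoʳ-≤ b n≤m) (<⇒≱ bᵐ<bⁿ)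

term<2^n⇒x<n : ∀ n x y → term x y < 2 ^ n → x < n
term<2^n⇒x<n n x y t< = ^-cancelˡ-< 2 (≤-<-trans (m≤m*n (2 ^ x) (3 ^ y) {{m^n≢0 3 y}}) t<)

-- Weakening `3 ^ y` to `2 ^ y` is crude, but gives both exponents the same range `upTo n` and costs
-- only a constant factor in the count of pairs.
term<2^n⇒y<n : ∀ n x y → term x y < 2 ^ n → y < n
term<2^n⇒y<n n x y t< = ^-cancelˡ-< 2 (≤-<-trans
  (≤-trans (^-monoˡ-≤ y (n≤1+n 2)) (m≤n*m (3 ^ y) (2 ^ x) {{m^n≢0 2 x}})) t<)

summands : ℕ → List ℕ
summands n = 0 ∷ cartesianProductWith term (upTo n) (upTo n)

-- Repetitions and values beyond `2 ^ n` are harmless, since the length only has to bound the number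
-- of short sums from above.
sums : ℕ → ℕ → List ℕ
sums n zero    = [ 0 ]
sums n (suc K) = cartesianProductWith _+_ (summands n) (sums n K)

length-summands : ∀ n → length (summands n) ≡ 1 + n * n
length-summands n = cong suc (trans (length-cartesianProductWith term (upTo n) (upTo n))
  (cong₂ _*_ (length-upTo n) (length-upTo n)))

length-sums : ∀ n K → length (sums n K) ≡ (1 + n * n) ^ K
length-sums n zero    = refl
length-sums n (suc K) = trans (length-cartesianProductWith _+_ (summands n) (sums n K))
  (cong₂ _*_ (length-summands n) (length-sums n K))

value∈sums : ∀ n {k K} (xs ys : Vec ℕ k) → k ≤ K → value xs ys < 2 ^ n → value xs ys ∈ sums n K
value∈sums n {K = zero}  []       []       k≤K       v< = here refl
-- A representation with fewer than `K` terms is padded with the summand 0.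
value∈sums n {K = suc K} []       []       k≤K       v< =
  ∈-cartesianProductWith⁺ _+_ {xs = summands n} (here refl) (value∈sums n {K = K} [] [] z≤n v<)
value∈sums n {K = suc K} (x ∷ xs) (y ∷ ys) (s≤s k≤K) v< =
  ∈-cartesianProductWith⁺ _+_ {xs = summands n}
    (there (∈-cartesianProductWith⁺ term (∈-upTo⁺ (term<2^n⇒x<n n x y t<))
                                         (∈-upTo⁺ (term<2^n⇒y<n n x y t<))))
    (value∈sums n xs ys k≤K (≤-<-trans (m≤n+m _ _) v<))
  where
  t< : term x y < 2 ^ n
  t< = ≤-<-trans (m≤m+n _ _) v<

k*≤K⇒∈sums : ∀ n K {m} → m < 2 ^ n → k* m ≤ K → m ∈ sums n K
k*≤K⇒∈sums n K {m} m< k≤K with fewestTerms m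
... | k , (xs , ys , refl) , _ = value∈sums n xs ys k≤K m<

sum-k*-lower : ∀ p K → (1 + suc p * suc p) ^ K ≤ 2 ^ p →
  2 ^ p * suc K ≤ sum (map k* (upTo (2 ^ suc p)))
-- With `n = suc p`, half of `2 ^ n` is `2 ^ p`. Adding that half on the left restores the full
-- count, and on the right it dominates the numbers that may have at most `K` terms.
sum-k*-lower p K few = +-cancelʳ-≤ (2 ^ p * suc K) _ _ (begin
  2 ^ p * suc K + 2 ^ p * suc K           ≡⟨ double (2 ^ p) (suc K) ⟩
  2 ^ suc p * suc K                       ≡⟨ cong (_* suc K) (length-upTo (2 ^ suc p)) ⟨
  length (upTo (2 ^ suc p)) * suc K       ≤⟨ length*bound≤sum k* (suc K) (sums (suc p) K) (upTo⁺ (2 ^ suc p))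
                                               (λ m∈ k<sK → k*≤K⇒∈sums (suc p) K (∈-upTo⁻ m∈) (s≤s⁻¹ k<sK)) ⟩
  S + length (sums (suc p) K) * suc K     ≡⟨ cong (λ l → S + l * suc K) (length-sums (suc p) K) ⟩
  S + (1 + suc p * suc p) ^ K * suc K     ≤⟨ +-monoʳ-≤ S (*-monoˡ-≤ (suc K) few) ⟩
  S + 2 ^ p * suc K                       ∎)
  where
  open ≤-Reasoning
  S : ℕ
  S = sum (map k* (upTo (2 ^ suc p)))
  double : ∀ a b → a * b + a * b ≡ 2 * a * b
  double = solve-∀

-- Choosing the number of terms.

binaryLog : ∀ n → ∃ λ ℓ → 2 ^ ℓ ≤ suc n × suc n < 2 ^ suc ℓ
binaryLog zero    = 0 , ≤-refl , ≤-refl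
binaryLog (suc n) with binaryLog n
... | ℓ , lo , hi with m≤n⇒m<n∨m≡n hi
...   | inj₁ lt = ℓ , ≤-trans lo (n≤1+n _) , lt
-- The logarithm grows exactly when the next number is a power of two.
...   | inj₂ eq = suc ℓ , ≤-reflexive (sym eq) ,
                  subst (_< 2 ^ suc (suc ℓ)) (sym eq) (^-monoʳ-< 2 ≤-refl (n<1+n (suc ℓ)))

-- The left side is at most `(1 + n)²`, hence at most `2 ^ (2 + 2 * ℓ)`; the summand 2 is absorbed
-- by another `2 * ℓ` because `1 ≤ ℓ`.
1+n²≤2^4ℓ : ∀ n ℓ → 1 ≤ ℓ → n < 2 ^ suc ℓ → 1 + n * n ≤ 2 ^ (4 * ℓ)
1+n²≤2^4ℓ n ℓ 1≤ℓ n< = begin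
  1 + n * n                 ≤⟨ m≤m+n _ (2 * n) ⟩
  1 + n * n + 2 * n         ≡⟨ square n ⟩
  suc n * suc n             ≤⟨ *-mono-≤ n< n< ⟩
  2 ^ suc ℓ * 2 ^ suc ℓ     ≡⟨ ^-distribˡ-+-* 2 (suc ℓ) (suc ℓ) ⟨
  2 ^ (suc ℓ + suc ℓ)       ≤⟨ ^-monoʳ-≤ 2 exponent ⟩
  2 ^ (4 * ℓ)               ∎
  where
  open ≤-Reasoning
  square : ∀ n → 1 + n * n + 2 * n ≡ suc n * suc n
  square = solve-∀
  twice : ∀ ℓ → ℓ + ℓ + (ℓ + ℓ) ≡ 4 * ℓ
  twice = solve-∀
  exponent : suc ℓ + suc ℓ ≤ 4 * ℓ
  exponent = ≤-trans (+-mono-≤ (+-monoˡ-≤ ℓ 1≤ℓ) (+-monoˡ-≤ ℓ 1≤ℓ)) (≤-reflexive (twice ℓ))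

-- The constant 8 is the 4 of the exponent `4 * ℓ` times a 2 for keeping only half of the numbers.
n*2ⁿ≤8ℓ*sum-k* : ∀ n ℓ → 1 ≤ n → 1 ≤ ℓ → n < 2 ^ suc ℓ →
  n * 2 ^ n ≤ 8 * (ℓ * sum (map k* (upTo (2 ^ n))))
n*2ⁿ≤8ℓ*sum-k* (suc p) ℓ@(suc _) _ 1≤ℓ n< = begin
  suc p * 2 ^ suc p               ≤⟨ *-monoˡ-≤ (2 ^ suc p) n≤ ⟩
  suc K * (4 * ℓ) * 2 ^ suc p     ≡⟨ rearrange (suc K) ℓ (2 ^ p) ⟩
  8 * (ℓ * (2 ^ p * suc K))       ≤⟨ *-monoʳ-≤ 8 (*-monoʳ-≤ ℓ (sum-k*-lower p K few)) ⟩
  8 * (ℓ * S)                     ∎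
  where
  open ≤-Reasoning
  S K : ℕ
  S = sum (map k* (upTo (2 ^ suc p)))
  -- The largest `K` with `(2 ^ (4 * ℓ)) ^ K ≤ 2 ^ p`. Matching `ℓ` as a successor makes the divisor
  -- visibly nonzero.
  K = p ℕ./ (4 * ℓ)
  rearrange : ∀ k ℓ d → k * (4 * ℓ) * (2 * d) ≡ 8 * (ℓ * (d * k))
  rearrange = solve-∀
  -- Rounding down loses less than one, so `suc K` makes up for it.
  n≤ : suc p ≤ suc K * (4 * ℓ)
  n≤ = subst (_< suc K * (4 * ℓ)) (sym (m≡m%n+[m/n]*n p (4 * ℓ)))
         (+-monoˡ-< (K * (4 * ℓ)) (m%n<n p (4 * ℓ)))
  few : (1 + suc p * suc p) ^ K ≤ 2 ^ p
  few = begin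
    (1 + suc p * suc p) ^ K   ≤⟨ ^-monoˡ-≤ K (1+n²≤2^4ℓ (suc p) ℓ 1≤ℓ n<) ⟩
    (2 ^ (4 * ℓ)) ^ K         ≡⟨ ^-*-assoc 2 (4 * ℓ) K ⟩
    2 ^ (4 * ℓ * K)           ≡⟨ cong (2 ^_) (*-comm (4 * ℓ) K) ⟩
    2 ^ (K * (4 * ℓ))         ≤⟨ ^-monoʳ-≤ 2 (m/n*n≤m p (4 * ℓ)) ⟩
    2 ^ p                     ∎

-- Passage to rationals and cuts.

/-mono-≤ : ∀ i j d e .{{_ : NonZero d}} .{{_ : NonZero e}} →
  i ℤ.* + e ℤ.≤ j ℤ.* + d → i / d ℚ.≤ j / e
-- Since `_/_` reduces to lowest terms, the fractions are compared unnormalised, where the order is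
-- cross-multiplication.
/-mono-≤ i j (suc d-1) (suc e-1) ie≤jd = ℚ.toℚᵘ-cancel-≤ (begin
  toℚᵘ (i / suc d-1)   ≃⟨ ℚ.toℚᵘ-fromℚᵘ (mkℚᵘ i d-1) ⟩
  mkℚᵘ i d-1           ≤⟨ *≤* ie≤jd ⟩
  mkℚᵘ j e-1           ≃⟨ ℚ.toℚᵘ-fromℚᵘ (mkℚᵘ j e-1) ⟨
  toℚᵘ (j / suc e-1)   ∎)
  where open ℚᵘ.≤-Reasoning

/-*-/ : ∀ i j d e .{{_ : NonZero d}} .{{_ : NonZero e}} →
  (i / d) ℚ.* (j / e) ≡ ((i ℤ.* j) / (d * e)) {{m*n≢0 d e}}
/-*-/ i j (suc d-1) (suc e-1) = ℚ.toℚᵘ-injective (begin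
  toℚᵘ ((i / suc d-1) ℚ.* (j / suc e-1))         ≈⟨ ℚ.toℚᵘ-homo-* (i / suc d-1) (j / suc e-1) ⟩
  toℚᵘ (i / suc d-1) ℚᵘ.* toℚᵘ (j / suc e-1)     ≈⟨ ℚᵘ.*-cong (ℚ.toℚᵘ-fromℚᵘ (mkℚᵘ i d-1)) (ℚ.toℚᵘ-fromℚᵘ (mkℚᵘ j e-1)) ⟩
  mkℚᵘ i d-1 ℚᵘ.* mkℚᵘ j e-1                     ≈⟨ ℚ.toℚᵘ-fromℚᵘ (mkℚᵘ i d-1 ℚᵘ.* mkℚᵘ j e-1) ⟨
  toℚᵘ ((i ℤ.* j) / (suc d-1 * suc e-1))         ∎)
  where open ℚᵘ.≃-Reasoning

-- If `r = a / b` lies above `lg n`, then `2 ^ (ℓ * b) ≤ n ^ b < 2 ^ a`, so `ℓ * b < a`.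
lg-lower : ∀ n ℓ → 2 ^ ℓ ≤ n → ∀ r → lg n r → + ℓ / 1 ℚ.≤ r
lg-lower n ℓ 2^ℓ≤n r@(mkℚ (+ a) b-1 _) n^b<2^a = begin
  + ℓ / 1             ≤⟨ /-mono-≤ (+ ℓ) (+ a) 1 (suc b-1) ℓb≤a*1 ⟩
  + a / suc b-1       ≡⟨ ℚ.↥p/↧p≡p r ⟩
  r                   ∎
  where
  open ℚ.≤-Reasoning
  ℓb<a : ℓ * suc b-1 < a
  ℓb<a = ^-cancelˡ-< 2 (≤-<-trans
    (subst (_≤ n ^ suc b-1) (^-*-assoc 2 ℓ (suc b-1)) (^-monoˡ-≤ (suc b-1) 2^ℓ≤n)) n^b<2^a)
  ℓb≤a*1 : + ℓ ℤ.* + suc b-1 ℤ.≤ + a ℤ.* + 1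
  ℓb≤a*1 = subst₂ ℤ._≤_ (ℤ.pos-* ℓ (suc b-1)) (sym (ℤ.*-identityʳ (+ a))) (ℤ.+≤+ (<⇒≤ ℓb<a))
-- No negative rational lies above `lg n`: as `1 ≤ n`, both factors are at least 1.
lg-lower n ℓ 2^ℓ≤n (mkℚ -[1+ a ] b-1 _) n^b*2^a<1 =
  contradiction (*-mono-≤ (m^n>0 n {{n≢0}} (suc b-1)) (m^n>0 2 (suc a))) (<⇒≱ n^b*2^a<1)
  where
  n≢0 : NonZero n
  n≢0 = >-nonZero (≤-trans (m^n>0 2 ℓ) 2^ℓ≤n)

-- Replacing `r` by the smaller `r₀` in `q * r < p` is sound for `q ≥ 0`. The cut also contains
-- negative `q`, for which the product is at most 0.
÷-lower : ∀ p u r₀ q → 0ℚ ℚ.≤ p → 0ℚ ℚ.≤ r₀ → (∀ r → u r → r₀ ℚ.≤ r) →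
  (p ÷ u) q → q ℚ.* r₀ ℚ.≤ p
÷-lower p u r₀ q 0≤p 0≤r₀ r₀≤ (r , ur , qr<p) with ℚ.≤-total 0ℚ q
... | inj₁ 0≤q = ℚ.≤-trans (ℚ.*-monoˡ-≤-nonNeg q {{ℚ.nonNegative 0≤q}} (r₀≤ r ur)) (ℚ.<⇒≤ qr<p)
... | inj₂ q≤0 = begin
  q ℚ.* r₀     ≤⟨ ℚ.*-monoʳ-≤-nonNeg r₀ {{ℚ.nonNegative 0≤r₀}} q≤0 ⟩
  0ℚ ℚ.* r₀    ≡⟨ ℚ.*-zeroˡ r₀ ⟩
  0ℚ           ≤⟨ 0≤p ⟩
  p            ∎
  where open ℚ.≤-Reasoning

0≤+n/1 : ∀ n → 0ℚ ℚ.≤ + n / 1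
0≤+n/1 n = ℚ.nonNegative⁻¹ (+ n / 1) {{ℚ.normalize-nonNeg n 1}}

n/8≤ℓ*𝒜* : ∀ n ℓ → 1 ≤ n → 1 ≤ ℓ → n < 2 ^ suc ℓ →
  (+ 1 / 8) ℚ.* (+ n / 1) ℚ.≤ (+ ℓ / 1) ℚ.* 𝒜* n
n/8≤ℓ*𝒜* n ℓ 1≤n 1≤ℓ n< = begin
  (+ 1 / 8) ℚ.* (+ n / 1)               ≡⟨ /-*-/ (+ 1) (+ n) 8 1 ⟩
  (+ 1 ℤ.* + n) / 8                     ≤⟨ /-mono-≤ (+ 1 ℤ.* + n) (+ ℓ ℤ.* + S) 8 (1 * 2 ^ n) cross ⟩
  (+ ℓ ℤ.* + S) / (1 * 2 ^ n)           ≡⟨ /-*-/ (+ ℓ) (+ S) 1 (2 ^ n) ⟨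
  (+ ℓ / 1) ℚ.* (+ S / 2 ^ n)           ∎
  where
  open ℚ.≤-Reasoning
  instance
    2^n≢0 : NonZero (2 ^ n)
    2^n≢0 = m^n≢0 2 n
    1*2^n≢0 : NonZero (1 * 2 ^ n)
    1*2^n≢0 = m*n≢0 1 (2 ^ n)
  S : ℕ
  S = sum (map k* (upTo (2 ^ n)))
  -- The natural-number bound, with the denominators 8 and `2 ^ n` multiplied across.
  cross : + 1 ℤ.* + n ℤ.* + (1 * 2 ^ n) ℤ.≤ + ℓ ℤ.* + S ℤ.* + 8
  cross = subst₂ ℤ._≤_
    (trans (ℤ.pos-* n (2 ^ n)) (cong₂ ℤ._*_ (sym (ℤ.*-identityˡ (+ n))) (cong +_ (sym (*-identityˡ (2 ^ n))))))
    (trans (cong +_ (*-comm 8 (ℓ * S))) (trans (ℤ.pos-* (ℓ * S) 8) (cong (ℤ._* + 8) (ℤ.pos-* ℓ S))))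
    (ℤ.+≤+ (n*2ⁿ≤8ℓ*sum-k* n ℓ 1≤n 1≤ℓ n<))

𝒜*-lower : ∀ n → 2 ≤ n → ∀ q → ((+ n / 1) ÷ lg n) q → (+ 1 / 8) ℚ.* q ℚ.≤ 𝒜* n
𝒜*-lower n@(suc p) 2≤n q q<n/lgn with binaryLog p
-- Here `n < 2`; otherwise `ℓ` is positive and can be cancelled, which replaces division by `ℓ`.
... | zero      , _  , hi = contradiction hi (≤⇒≯ 2≤n)
... | ℓ@(suc _) , lo , hi = ℚ.*-cancelˡ-≤-pos (+ ℓ / 1) {{ℚ.normalize-pos ℓ 1}} (begin
  (+ ℓ / 1) ℚ.* ((+ 1 / 8) ℚ.* q)    ≡⟨ ℚ.*-comm (+ ℓ / 1) _ ⟩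
  (+ 1 / 8) ℚ.* q ℚ.* (+ ℓ / 1)      ≡⟨ ℚ.*-assoc (+ 1 / 8) q (+ ℓ / 1) ⟩
  (+ 1 / 8) ℚ.* (q ℚ.* (+ ℓ / 1))    ≤⟨ ℚ.*-monoˡ-≤-nonNeg (+ 1 / 8)
                                          (÷-lower (+ n / 1) (lg n) (+ ℓ / 1) q (0≤+n/1 n) (0≤+n/1 ℓ) (lg-lower n ℓ lo) q<n/lgn) ⟩
  (+ 1 / 8) ℚ.* (+ n / 1)            ≤⟨ n/8≤ℓ*𝒜* n ℓ (s≤s z≤n) (s≤s z≤n) hi ⟩
  (+ ℓ / 1) ℚ.* 𝒜* n                 ∎)
  where open ℚ.≤-Reasoning

theorem1 : 𝒜* ∈Ω (λ n → (+ n / 1) ÷ lg n)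
-- The threshold 2 is the first `n` whose binary logarithm, rounded down, is positive.
theorem1 = + 1 / 8 , ℚ.positive⁻¹ (+ 1 / 8) , 2 , 𝒜*-lower
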